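{- Let $(C_n)_{n\geq 1}$ and $(\delta_n)_{n\geq 0}$ be sequences of formal variables (or complex numbers) with $\delta_0=1$, and put $C(z)=\sum_{n\geq1}C_n z^{n-1}$ and $\Delta(z)=\sum_{n\geq0}\delta_n z^{n+1}$. Let $M(z)=\sum_{n\geq0}M_n z^{n+1}$ be the formal power series determined by \[ M(z)=\frac{z}{1-z\,C\big(M(z)\odot\Delta(z)\big)}. \] Then for every $n\geq 2$, \[ C_n=\frac{1}{n-1}\,[z^{ -1}]\;\frac{\dfrac{M'(z)}{M(z)^2}-\dfrac{1}{z^2}}{\big(M(z)\odot\Delta(z)\big)^{n-1}}, \] where the right-hand side is computed in formal Laurent series.
   Context: The Hadamard product of two formal power series is $\big(\sum a_nz^n\big)\odot\big(\sum b_nz^n\big)=\sum a_nb_nz^n$. For a formal Laurent series $g(z)$, $[z^k]g(z)$ denotes its coefficient of $z^k$. The functional equation is equivalent to Yoshida's relation $M_n=\sum_{\pi\in\mathrm{NC}_n}\prod_{B\in\pi}C_{\#B}\prod_{(i,j)\text{ arc of }\pi}\delta_{j-i-1}$ (the $C_n$ are the $\Delta$-cumulants of the moments $M_n$). -}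

module Defs where

open import Level using (Level)
open import Algebra.Bundles using (CommutativeRing)
open import Data.Nat as ℕ using (ℕ; zero; suc)
open import Data.Integer as ℤ using (ℤ; +_; -[1+_])
open import Data.List using (List; []; _∷_)
open import Data.Product using (_×_; _,_; proj₁; proj₂)
open import Relation.Binary.PropositionalEquality using (_≡_)

module Series {c ℓ : Level} (R : CommutativeRing c ℓ) where
  open CommutativeRing R

  _·_ : ℕ → Carrier → Carrier
  zero  · x = 0#
  suc n · x = x + n · x

  Σ≤ : ℕ → (ℕ → Carrier) → Carrier
  Σ≤ zero    f = f 0
  Σ≤ (suc k) f = Σ≤ k f + f (suc k)

  -- Formal power series: coefficient functions  k ↦ [z^k]
  PS : Set c
  PS = ℕ → Carrier

  zPS : PS
  zPS zero          = 0#
  zPS (suc zero)    = 1#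
  zPS (suc (suc _)) = 0#

  onePS : PS
  onePS zero    = 1#
  onePS (suc _) = 0#

  _⊕_ : PS → PS → PS
  (a ⊕ b) k = a k + b k

  _⊖_ : PS → PS → PS
  (a ⊖ b) k = a k - b k

  _⊗_ : PS → PS → PS
  (a ⊗ b) k = Σ≤ k (λ i → a i * b (k ℕ.∸ i))

  _⊙_ : PS → PS → PS
  (a ⊙ b) k = a k * b k

  _^ps_ : PS → ℕ → PS
  a ^ps zero    = onePS
  a ^ps (suc j) = a ⊗ (a ^ps j)

  -- Composition f(g) for g with zero constant term:
  -- [z^k] f(g) = Σ_{j=0}^{k} f_j [z^k] g^j  (terms j > k vanish as g_0 = 0).
  _∘ps_ : PS → PS → PS
  (f ∘ps g) k = Σ≤ k (λ j → f j * (g ^ps j) k)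

  -- Multiplicative inverse of a power series with constant term 1:
  -- b_0 = 1, b_k = - Σ_{i=1}^{k} a_i b_{k-i}.
  -- invPrefix a k = [b_k , b_{k-1} , … , b_0]
  private
    step : PS → ℕ → List Carrier → Carrier
    step a j []       = 0#
    step a j (b ∷ bs) = a (suc j) * b + step a (suc j) bs

  invPrefix : PS → ℕ → List Carrier
  invPrefix a zero    = 1# ∷ []
  invPrefix a (suc k) = (- step a 0 (invPrefix a k)) ∷ invPrefix a k

  inv : PS → PS
  inv a k with invPrefix a k
  ... | []    = 0#
  ... | b ∷ _ = b

  deriv : PS → PS
  deriv a k = suc k · a (suc k)

  -- Formal Laurent series: a pair (v , a) standing for z^v · Σ_k a_k z^k
  LS : Set c
  LS = ℤ × PS

  coeff : LS → ℤ → Carrier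
  coeff (v , a) k with k ℤ.- v
  ... | + i      = a i
  ... | -[1+ _ ] = 0#

  fromPS : PS → LS
  fromPS a = (+ 0 , a)

  -- a power series a with a_0 = 0, viewed as the Laurent series
  -- z^1 · Σ_k a_{k+1} z^k  (same series, representation with offset 1)
  fromPS₁ : PS → LS
  fromPS₁ a = (+ 1 , λ k → a (suc k))

  zpow : ℤ → LS
  zpow m = (m , onePS)

  _+L_ : LS → LS → LS
  x +L y = (v , λ k → coeff x (v ℤ.+ + k) + coeff y (v ℤ.+ + k))
    where v = proj₁ x ℤ.⊓ proj₁ y

  -L_ : LS → LS
  -L (v , a) = (v , λ k → - a k)

  _-L_ : LS → LS → LS
  x -L y = x +L (-L y)

  _*L_ : LS → LS → LS
  (v , a) *L (w , b) = (v ℤ.+ w , a ⊗ b)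

  _^L_ : LS → ℕ → LS
  x ^L zero    = fromPS onePS
  x ^L (suc j) = x *L (x ^L j)

  -- inverse of a Laurent series represented as z^v (a_0 + a_1 z + …)
  -- with a_0 = 1 (only used on such representations)
  invL : LS → LS
  invL (v , a) = (ℤ.- v , inv a)

  _/L_ : LS → LS → LS
  x /L y = x *L invL y

  -- The series of the paper, built from the sequences
  --   C n  (n ≥ 1; C 0 is unused),  δ n (n ≥ 0),  M n (n ≥ 0).

  Cser : (ℕ → Carrier) → PS
  Cser C j = C (suc j)

  shift1 : (ℕ → Carrier) → PS
  shift1 s zero    = 0#
  shift1 s (suc n) = s n

{-# OPTIONS --safe #-}
module Submission where

-- Write M̂ = z M, G = M̂ ⊙ Δ = z g, E = C(G), h = 1/g and θ = z d/dz. Since 1/M̂ = 1/z − E, the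
-- numerator M̂′/M̂² − 1/z² is E′ = θE / z, so the claim is (n−1) C_n = [z^m] θE · h^m with
-- m = n−1. Expanding E = Σ_j C_{j+1} G^j, the term j = m gives m C_{m+1}, and a term 0 < j < m
-- is j C_{j+1} times [z^r] (h^r − h^{r−1} θh), r = m − j. That this vanishes is usually obtained
-- by dividing (h^r)′ by r; the coefficient ring being arbitrary, it is proved here without
-- division, from the stronger statement `power-coeff`.

open import Defs
open import Level using (Level; _⊔_)
open import Algebra.Bundles using (CommutativeRing)
open import Algebra.Structures using (IsCommutativeRing)
import Algebra.Construct.Pointwise as Pointwise
import Algebra.Properties.AbelianGroup as AbelianGroup
import Algebra.Properties.CommutativeSemiring.Exp as Exp
import Algebra.Properties.Semiring.Mult as Mult
import Algebra.Properties.Semiring.Sum as Sum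
open import Data.Fin using (Fin; zero; suc; toℕ)
open import Data.Integer as ℤ using (+_; -[1+_])
import Data.Integer.Properties as ℤ
open import Data.List using (List)
open import Data.Nat as ℕ using (ℕ; zero; suc; z≤n; s≤s; _≥_; _∸_)
import Data.Nat.Properties as ℕ
open import Data.Nat.Combinatorics using (nC1≡n; nCk+nC[k+1]≡[n+1]C[k+1])
  renaming (_C_ to _choose_)
open import Data.Nat.Solver using (module +-*-Solver)
open import Data.Product using (∃-syntax; _,_) renaming (_×_ to _∧_)
open import Data.Sum using (_⊎_; inj₁; inj₂)
open import Relation.Binary.PropositionalEquality as ≡ using (_≡_)

-- The commutative ring of formal power series and its multiplicative inverses.

module PowerSeriesRing {c ℓ : Level} (R : CommutativeRing c ℓ) where
  open CommutativeRing R hiding (zero)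
  open Series R
  open import Algebra.Properties.CommutativeSemigroup +-commutativeSemigroup using (interchange)
  open import Relation.Binary.Reasoning.Setoid setoid

  infix 4 _≋_
  _≋_ : PS → PS → Set ℓ
  a ≋ b = ∀ k → a k ≈ b k

  tail : PS → PS
  tail a k = a (suc k)

  const : Carrier → PS
  const x zero    = x
  const x (suc _) = 0#

  Σ≤-cong-≤ : ∀ k {f g : PS} → (∀ i → i ℕ.≤ k → f i ≈ g i) → Σ≤ k f ≈ Σ≤ k g
  Σ≤-cong-≤ zero    f≈g = f≈g 0 z≤n
  Σ≤-cong-≤ (suc k) f≈g =
    +-cong (Σ≤-cong-≤ k λ i i≤k → f≈g i (ℕ.m≤n⇒m≤1+n i≤k)) (f≈g (suc k) ℕ.≤-refl)

  Σ≤-cong : ∀ k {f g : PS} → f ≋ g → Σ≤ k f ≈ Σ≤ k g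
  Σ≤-cong k f≋g = Σ≤-cong-≤ k λ i _ → f≋g i

  Σ≤-zero : ∀ k {f : PS} → (∀ i → i ℕ.≤ k → f i ≈ 0#) → Σ≤ k f ≈ 0#
  Σ≤-zero zero    f≈0 = f≈0 0 z≤n
  Σ≤-zero (suc k) f≈0 =
    trans (+-cong (Σ≤-zero k λ i i≤k → f≈0 i (ℕ.m≤n⇒m≤1+n i≤k)) (f≈0 (suc k) ℕ.≤-refl))
          (+-identityʳ 0#)

  Σ≤-+ : ∀ k (f g : PS) → Σ≤ k (f ⊕ g) ≈ Σ≤ k f + Σ≤ k g
  Σ≤-+ zero    f g = refl
  Σ≤-+ (suc k) f g = trans (+-congʳ (Σ≤-+ k f g)) (interchange _ _ _ _)

  Σ≤-*ˡ : ∀ k x (f : PS) → Σ≤ k (λ i → x * f i) ≈ x * Σ≤ k f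
  Σ≤-*ˡ zero    x f = refl
  Σ≤-*ˡ (suc k) x f = trans (+-congʳ (Σ≤-*ˡ k x f)) (sym (distribˡ x _ _))

  Σ≤-head : ∀ k (f : PS) → Σ≤ (suc k) f ≈ f 0 + Σ≤ k (tail f)
  Σ≤-head zero    f = refl
  Σ≤-head (suc k) f = trans (+-congʳ (Σ≤-head k f)) (+-assoc _ _ _)

  Σ≤-extend : ∀ {k n} {f : PS} → k ℕ.≤ n → (∀ i → k ℕ.< i → f i ≈ 0#) → Σ≤ k f ≈ Σ≤ n f
  Σ≤-extend {k} {n} {f} k≤n f≈0 = go (ℕ.≤⇒≤′ k≤n)
    where
    go : ∀ {m} → k ℕ.≤′ m → Σ≤ k f ≈ Σ≤ m f
    go ℕ.≤′-refl              = refl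
    go (ℕ.≤′-step {m} k≤′m) = begin
      Σ≤ k f             ≈⟨ go k≤′m ⟩
      Σ≤ m f             ≈⟨ +-identityʳ _ ⟨
      Σ≤ m f + 0#        ≈⟨ +-congˡ (f≈0 (suc m) (s≤s (ℕ.≤′⇒≤ k≤′m))) ⟨
      Σ≤ m f + f (suc m) ∎

  -- Peeling off the first term of a convolution here, and the last in `⊗-sucʳ`, allows
  -- commutativity and associativity to be proved by induction on the degree, with no reindexing of
  -- double sums.
  ⊗-suc : ∀ a b k → (a ⊗ b) (suc k) ≈ a 0 * b (suc k) + (tail a ⊗ b) k
  ⊗-suc a b k = Σ≤-head k (λ i → a i * b (suc k ℕ.∸ i))

  ⊗-sucʳ : ∀ a b k → (a ⊗ b) (suc k) ≈ (a ⊗ tail b) k + a (suc k) * b 0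
  ⊗-sucʳ a b k = +-cong
    (Σ≤-cong-≤ k λ i i≤k → *-congˡ (reflexive (≡.cong b (ℕ.+-∸-assoc 1 i≤k))))
    (*-congˡ (reflexive (≡.cong b (ℕ.n∸n≡0 k))))

  -- The left factor enters only through its coefficients up to `k`. `lagrange` needs this, because
  -- there a composition agrees with a finite combination only up to a given degree.
  ⊗-cong-≤ : ∀ k {a a′ b b′} → (∀ i → i ℕ.≤ k → a i ≈ a′ i) → b ≋ b′ → (a ⊗ b) k ≈ (a′ ⊗ b′) k
  ⊗-cong-≤ k a≈a′ b≋b′ = Σ≤-cong-≤ k λ i i≤k → *-cong (a≈a′ i i≤k) (b≋b′ (k ℕ.∸ i))

  ⊗-cong : ∀ {a a′ b b′} → a ≋ a′ → b ≋ b′ → a ⊗ b ≋ a′ ⊗ b′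
  ⊗-cong a≋a′ b≋b′ k = ⊗-cong-≤ k (λ i _ → a≋a′ i) b≋b′

  ⊗-comm : ∀ a b → a ⊗ b ≋ b ⊗ a
  ⊗-comm a b zero    = *-comm _ _
  ⊗-comm a b (suc k) = begin
    (a ⊗ b) (suc k)                     ≈⟨ ⊗-suc a b k ⟩
    a 0 * b (suc k) + (tail a ⊗ b) k    ≈⟨ +-cong (*-comm _ _) (⊗-comm (tail a) b k) ⟩
    b (suc k) * a 0 + (b ⊗ tail a) k    ≈⟨ +-comm _ _ ⟩
    (b ⊗ tail a) k + b (suc k) * a 0    ≈⟨ ⊗-sucʳ b a k ⟨
    (b ⊗ a) (suc k)                     ∎

  const⊗ : ∀ x f k → (const x ⊗ f) k ≈ x * f k
  const⊗ x f zero    = refl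
  const⊗ x f (suc k) = begin
    (const x ⊗ f) (suc k)                    ≈⟨ ⊗-suc (const x) f k ⟩
    x * f (suc k) + (tail (const x) ⊗ f) k   ≈⟨ +-congˡ (Σ≤-zero k λ i _ → zeroˡ _) ⟩
    x * f (suc k) + 0#                       ≈⟨ +-identityʳ _ ⟩
    x * f (suc k)                            ∎

  scale-⊗ : ∀ x a b k → ((λ i → x * a i) ⊗ b) k ≈ x * (a ⊗ b) k
  scale-⊗ x a b k = trans (Σ≤-cong k λ i → *-assoc x _ _) (Σ≤-*ˡ k x _)

  ⊗-distribʳ : ∀ c a b → (a ⊕ b) ⊗ c ≋ (a ⊗ c) ⊕ (b ⊗ c)
  ⊗-distribʳ c a b k = trans (Σ≤-cong k λ i → distribʳ _ _ _) (Σ≤-+ k _ _)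

  ⊗-distribˡ : ∀ c a b → c ⊗ (a ⊕ b) ≋ (c ⊗ a) ⊕ (c ⊗ b)
  ⊗-distribˡ c a b k = trans (Σ≤-cong k λ i → distribˡ _ _ _) (Σ≤-+ k _ _)

  ⊗-assoc : ∀ a b c → (a ⊗ b) ⊗ c ≋ a ⊗ (b ⊗ c)
  ⊗-assoc a b c zero    = *-assoc _ _ _
  ⊗-assoc a b c (suc k) = begin
    ((a ⊗ b) ⊗ c) (suc k)
      ≈⟨ ⊗-suc (a ⊗ b) c k ⟩
    (a 0 * b 0) * c (suc k) + (tail (a ⊗ b) ⊗ c) k
      ≈⟨ +-cong (*-assoc _ _ _) (⊗-cong {b = c} (⊗-suc a b) (λ _ → refl) k) ⟩
    a 0 * (b 0 * c (suc k)) + (((λ i → a 0 * tail b i) ⊕ (tail a ⊗ b)) ⊗ c) k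
      ≈⟨ +-congˡ (⊗-distribʳ c _ _ k) ⟩
    a 0 * (b 0 * c (suc k)) + (((λ i → a 0 * tail b i) ⊗ c) k + ((tail a ⊗ b) ⊗ c) k)
      ≈⟨ +-congˡ (+-cong (scale-⊗ (a 0) (tail b) c k) (⊗-assoc (tail a) b c k)) ⟩
    a 0 * (b 0 * c (suc k)) + (a 0 * (tail b ⊗ c) k + (tail a ⊗ (b ⊗ c)) k)
      ≈⟨ +-assoc _ _ _ ⟨
    (a 0 * (b 0 * c (suc k)) + a 0 * (tail b ⊗ c) k) + (tail a ⊗ (b ⊗ c)) k
      ≈⟨ +-congʳ (distribˡ _ _ _) ⟨
    a 0 * (b 0 * c (suc k) + (tail b ⊗ c) k) + (tail a ⊗ (b ⊗ c)) k
      ≈⟨ +-congʳ (*-congˡ (⊗-suc b c k)) ⟨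
    a 0 * (b ⊗ c) (suc k) + (tail a ⊗ (b ⊗ c)) k
      ≈⟨ ⊗-suc a (b ⊗ c) k ⟨
    (a ⊗ (b ⊗ c)) (suc k) ∎

  onePS≋const : onePS ≋ const 1#
  onePS≋const zero    = refl
  onePS≋const (suc _) = refl

  ⊗-identityˡ : ∀ a → onePS ⊗ a ≋ a
  ⊗-identityˡ a k = begin
    (onePS ⊗ a) k    ≈⟨ ⊗-cong {b = a} onePS≋const (λ _ → refl) k ⟩
    (const 1# ⊗ a) k ≈⟨ const⊗ 1# a k ⟩
    1# * a k         ≈⟨ *-identityˡ _ ⟩
    a k              ∎

  ⊗-identityʳ : ∀ a → a ⊗ onePS ≋ a
  ⊗-identityʳ a k = trans (⊗-comm a onePS k) (⊗-identityˡ a k)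

  ⊗-isCommutativeRing : IsCommutativeRing _≋_ _⊕_ _⊗_ (λ a k → - a k) (λ _ → 0#) onePS
  ⊗-isCommutativeRing = record
    { isRing = record
      { +-isAbelianGroup = Pointwise.isAbelianGroup ℕ +-isAbelianGroup
      ; *-cong           = ⊗-cong
      ; *-assoc          = ⊗-assoc
      ; *-identity       = ⊗-identityˡ , ⊗-identityʳ
      ; distrib          = ⊗-distribˡ , ⊗-distribʳ
      }
    ; *-comm = ⊗-comm
    }

  powerSeriesRing : CommutativeRing c ℓ
  powerSeriesRing = record { isCommutativeRing = ⊗-isCommutativeRing }

  -- The recursion inside `inv` is private to its module. Abstracting its arguments to distinct
  -- variables in `inv-suc` lets unification solve the `_` below with that very function.
  mutual
    dot : PS → ℕ → List Carrier → Carrier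
    dot = _

    inv-suc : ∀ a k → inv a (suc k) ≡ - dot a 0 (invPrefix a k)
    inv-suc a k with 0 | invPrefix a k
    ... | j | bs = ≡.refl

  -- `invPrefix` lists the coefficients of the inverse in descending order, so pairing them with
  -- ascending coefficients of `a` is a convolution. The offset `j` is arbitrary because the
  -- recursion raises it at each entry.
  dot-invPrefix : ∀ a j k → dot a j (invPrefix a k) ≈ ((λ i → a (suc (i ℕ.+ j))) ⊗ inv a) k
  dot-invPrefix a j zero    = +-identityʳ _
  dot-invPrefix a j (suc k) = begin
    a (suc j) * inv a (suc k) + dot a (suc j) (invPrefix a k)
      ≈⟨ +-congˡ (dot-invPrefix a (suc j) k) ⟩
    a (suc j) * inv a (suc k) + ((λ i → a (suc (i ℕ.+ suc j))) ⊗ inv a) k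
      ≈⟨ +-congˡ (⊗-cong {b = inv a}
           (λ i → reflexive (≡.cong (λ n → a (suc n)) (ℕ.+-suc i j))) (λ _ → refl) k) ⟩
    a (suc j) * inv a (suc k) + ((λ i → a (suc (suc i ℕ.+ j))) ⊗ inv a) k
      ≈⟨ ⊗-suc (λ i → a (suc (i ℕ.+ j))) (inv a) k ⟨
    ((λ i → a (suc (i ℕ.+ j))) ⊗ inv a) (suc k) ∎

  ⊗-inv : ∀ a → a 0 ≈ 1# → a ⊗ inv a ≋ onePS
  ⊗-inv a a₀≈1 zero    = trans (*-identityʳ _) a₀≈1
  ⊗-inv a a₀≈1 (suc k) = begin
    (a ⊗ inv a) (suc k)                            ≈⟨ ⊗-suc a (inv a) k ⟩
    a 0 * inv a (suc k) + (tail a ⊗ inv a) k       ≈⟨ +-cong (trans (*-congʳ a₀≈1) (*-identityˡ _)) tail⊗inv ⟩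
    inv a (suc k) + dot a 0 (invPrefix a k)        ≈⟨ +-congʳ (reflexive (inv-suc a k)) ⟩
    - dot a 0 (invPrefix a k) + dot a 0 (invPrefix a k) ≈⟨ -‿inverseˡ _ ⟩
    0#                                             ∎
    where
    tail⊗inv : (tail a ⊗ inv a) k ≈ dot a 0 (invPrefix a k)
    tail⊗inv = sym (trans (dot-invPrefix a 0 k)
      (⊗-cong {b = inv a} (λ i → reflexive (≡.cong (λ n → a (suc n)) (ℕ.+-identityʳ i))) (λ _ → refl) k))

  inv-unique : ∀ a b → a 0 ≈ 1# → a ⊗ b ≋ onePS → inv a ≋ b
  inv-unique a b a₀≈1 ab≋1 k = begin
    inv a k                ≈⟨ ⊗-identityˡ (inv a) k ⟨
    (onePS ⊗ inv a) k      ≈⟨ ⊗-cong {b = inv a} ab≋1 (λ _ → refl) k ⟨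
    ((a ⊗ b) ⊗ inv a) k    ≈⟨ ⊗-cong {b = inv a} (⊗-comm a b) (λ _ → refl) k ⟩
    ((b ⊗ a) ⊗ inv a) k    ≈⟨ ⊗-assoc b a (inv a) k ⟩
    (b ⊗ (a ⊗ inv a)) k    ≈⟨ ⊗-cong (λ _ → refl) (⊗-inv a a₀≈1) k ⟩
    (b ⊗ onePS) k          ≈⟨ ⊗-identityʳ b k ⟩
    b k                    ∎

-- Calculus of a derivation on a commutative ring.

record Derivation {c ℓ : Level} (R : CommutativeRing c ℓ) : Set (c ⊔ ℓ) where
  open CommutativeRing R hiding (zero)
  field
    θ      : Carrier → Carrier
    θ-cong : ∀ {x y} → x ≈ y → θ x ≈ θ y
    θ-+    : ∀ x y → θ (x + y) ≈ θ x + θ y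
    θ-*    : ∀ x y → θ (x * y) ≈ θ x * y + x * θ y

  open import Algebra.Properties.Group +-group using (inverseˡ-unique)
  open AbelianGroup +-abelianGroup using (xyx⁻¹≈y)
  open import Algebra.Properties.Ring ring using (x+x≈x⇒x≈0)
  open Exp commutativeSemiring using (_^_; ^-congˡ; ^-homo-*; ^-distrib-*)
  open Mult semiring using (_×_; ×-congʳ; ×-comm-*; ×-assoc-*)
  open import Algebra.Solver.Ring.NaturalCoefficients.Default commutativeSemiring
    using (solve; _:*_; _:+_; _:=_)
  open import Relation.Binary.Reasoning.Setoid setoid

  θ-1# : θ 1# ≈ 0#
  θ-1# = x+x≈x⇒x≈0 (θ 1#) (begin
    θ 1# + θ 1#            ≈⟨ +-cong (*-identityʳ _) (*-identityˡ _) ⟨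
    θ 1# * 1# + 1# * θ 1#  ≈⟨ θ-* 1# 1# ⟨
    θ (1# * 1#)            ≈⟨ θ-cong (*-identityˡ 1#) ⟩
    θ 1#                   ∎)

  θ-^ : ∀ x n → θ (x ^ suc n) ≈ suc n × (x ^ n * θ x)
  θ-^ x zero    = begin
    θ (x * 1#)            ≈⟨ θ-cong (*-identityʳ x) ⟩
    θ x                   ≈⟨ *-identityˡ _ ⟨
    1# * θ x              ≈⟨ +-identityʳ _ ⟨
    1# * θ x + 0#         ∎
  θ-^ x (suc n) = begin
    θ (x * x ^ suc n)                                ≈⟨ θ-* x (x ^ suc n) ⟩
    θ x * x ^ suc n + x * θ (x ^ suc n)              ≈⟨ +-cong (*-comm _ _) (*-congˡ (θ-^ x n)) ⟩
    x ^ suc n * θ x + x * (suc n × (x ^ n * θ x))    ≈⟨ +-congˡ (×-comm-* (suc n) x _) ⟩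
    x ^ suc n * θ x + suc n × (x * (x ^ n * θ x))    ≈⟨ +-congˡ (×-congʳ (suc n) (*-assoc x _ _)) ⟨
    x ^ suc n * θ x + suc n × (x ^ suc n * θ x)      ∎

  -- Apply `θ` to `x * y ≈ 1#` and multiply by `y`: the derivative of a reciprocal, without
  -- division.
  θ-inverse : ∀ {x y} → x * y ≈ 1# → θ x * (y * y) ≈ - θ y
  θ-inverse {x} {y} xy≈1 = inverseˡ-unique _ _ (begin
    θ x * (y * y) + θ y             ≈⟨ +-congˡ (*-identityʳ _) ⟨
    θ x * (y * y) + θ y * 1#        ≈⟨ +-congˡ (*-congˡ xy≈1) ⟨
    θ x * (y * y) + θ y * (x * y)   ≈⟨ solve 4 (λ x y x′ y′ →
                                         x′ :* (y :* y) :+ y′ :* (x :* y) :=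
                                         (x′ :* y :+ x :* y′) :* y) refl x y (θ x) (θ y) ⟩
    (θ x * y + x * θ y) * y         ≈⟨ *-congʳ (θ-* x y) ⟨
    θ (x * y) * y                   ≈⟨ *-congʳ (trans (θ-cong xy≈1) θ-1#) ⟩
    0# * y                          ≈⟨ zeroˡ y ⟩
    0#                              ∎)

  1^n≈1 : ∀ n → 1# ^ n ≈ 1#
  1^n≈1 zero    = refl
  1^n≈1 (suc n) = trans (*-identityˡ _) (1^n≈1 n)

  ^-inverse : ∀ {x y} → x * y ≈ 1# → ∀ n → x ^ n * y ^ n ≈ 1#
  ^-inverse {x} {y} xy≈1 n = begin
    x ^ n * y ^ n  ≈⟨ ^-distrib-* x y n ⟨
    (x * y) ^ n    ≈⟨ ^-congˡ n xy≈1 ⟩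
    1# ^ n         ≈⟨ 1^n≈1 n ⟩
    1#             ∎

  module _ {z : Carrier} (θz≈z : θ z ≈ z) where

    θ-z* : ∀ x → θ (z * x) ≈ z * (x + θ x)
    θ-z* x = begin
      θ (z * x)         ≈⟨ θ-* z x ⟩
      θ z * x + z * θ x ≈⟨ +-congʳ (*-congʳ θz≈z) ⟩
      z * x + z * θ x   ≈⟨ distribˡ z x (θ x) ⟨
      z * (x + θ x)     ∎

    -- (M + θM)/M² − 1 is z² (M̂′/M̂² − 1/z²) for M̂ = z M, where 1/M = D = 1 − z E.
    θ-reciprocal : ∀ {M D E} → M * D ≈ 1# → D + z * E ≈ 1# → (M + θ M) * (D * D) - 1# ≈ z * θ E
    θ-reciprocal {M} {D} {E} MD≈1 D+zE≈1 = begin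
      (M + θ M) * (D * D) - 1#
        ≈⟨ +-congʳ (distribʳ (D * D) M (θ M)) ⟩
      (M * (D * D) + θ M * (D * D)) - 1#
        ≈⟨ +-congʳ (+-cong (trans (sym (*-assoc M D D)) (trans (*-congʳ MD≈1) (*-identityˡ D)))
                           (θ-inverse MD≈1)) ⟩
      (D - θ D) - 1#
        ≈⟨ +-congʳ (+-congˡ -θD≈) ⟩
      (D + z * (E + θ E)) - 1#
        ≈⟨ +-congʳ (+-congˡ (distribˡ z E (θ E))) ⟩
      (D + (z * E + z * θ E)) - 1#
        ≈⟨ +-congʳ (+-assoc D _ _) ⟨
      ((D + z * E) + z * θ E) - 1#
        ≈⟨ +-congʳ (+-congʳ D+zE≈1) ⟩
      (1# + z * θ E) - 1#
        ≈⟨ xyx⁻¹≈y 1# (z * θ E) ⟩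
      z * θ E ∎
      where
      -θD≈ : - θ D ≈ z * (E + θ E)
      -θD≈ = sym (inverseˡ-unique _ _ (begin
        z * (E + θ E) + θ D ≈⟨ +-congʳ (θ-z* E) ⟨
        θ (z * E) + θ D     ≈⟨ +-comm _ _ ⟩
        θ D + θ (z * E)     ≈⟨ θ-+ D (z * E) ⟨
        θ (D + z * E)       ≈⟨ θ-cong D+zE≈1 ⟩
        θ 1#                ≈⟨ θ-1# ⟩
        0#                  ∎))

    -- For G = z g and j = i + 1, θ(G^j) = j G^i θG with θG = z (g + θg); then `g ^ i` cancels
    -- against `h ^ i`. What remains is z^j times a series that depends only on r. Its second
    -- summand stays in the form `θ g * h ^ suc r`, instead of -h^(r-1) θh, so that r = 0 is covered
    -- too.
    θ-power-quotient : ∀ {g h} → g * h ≈ 1# → ∀ i r →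
      θ ((z * g) ^ suc i) * h ^ (suc i ℕ.+ r) ≈ suc i × (z ^ suc i * (h ^ r + θ g * h ^ suc r))
    θ-power-quotient {g} {h} gh≈1 i r = begin
      θ ((z * g) ^ suc i) * h ^ (suc i ℕ.+ r)
        ≈⟨ *-congʳ (θ-^ (z * g) i) ⟩
      (suc i × ((z * g) ^ i * θ (z * g))) * h ^ (suc i ℕ.+ r)
        ≈⟨ ×-assoc-* (suc i) _ _ ⟩
      suc i × (((z * g) ^ i * θ (z * g)) * h ^ (suc i ℕ.+ r))
        ≈⟨ ×-congʳ (suc i) (*-cong (*-cong (^-distrib-* z g i) (θ-z* g)) (*-congˡ (^-homo-* h i r))) ⟩
      suc i × (((z ^ i * g ^ i) * (z * (g + θ g))) * (h * (h ^ i * h ^ r)))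
        ≈⟨ ×-congʳ (suc i) (solve 7 (λ z zⁱ gⁱ u h hⁱ hʳ →
             ((zⁱ :* gⁱ) :* (z :* u)) :* (h :* (hⁱ :* hʳ)) := (z :* zⁱ) :* ((gⁱ :* hⁱ) :* (u :* (h :* hʳ))))
             refl z (z ^ i) (g ^ i) (g + θ g) h (h ^ i) (h ^ r)) ⟩
      suc i × (z ^ suc i * ((g ^ i * h ^ i) * ((g + θ g) * h ^ suc r)))
        ≈⟨ ×-congʳ (suc i) (*-congˡ (trans (*-congʳ (^-inverse gh≈1 i)) (*-identityˡ _))) ⟩
      suc i × (z ^ suc i * ((g + θ g) * h ^ suc r))
        ≈⟨ ×-congʳ (suc i) (*-congˡ (distribʳ _ _ _)) ⟩
      suc i × (z ^ suc i * (g * h ^ suc r + θ g * h ^ suc r))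
        ≈⟨ ×-congʳ (suc i) (*-congˡ (+-congʳ (trans (sym (*-assoc _ _ _))
             (trans (*-congʳ gh≈1) (*-identityˡ _))))) ⟩
      suc i × (z ^ suc i * (h ^ r + θ g * h ^ suc r)) ∎

-- Binomial coefficients and the weights of the comparison.

-- Induction on `n`, with Pascal's rule used to split the left side and then to reassemble the right
-- side.
C-absorption : ∀ n k → suc k ℕ.* (suc n choose suc k) ≡ suc n ℕ.* (n choose k)
C-absorption zero    zero    = ≡.refl
C-absorption zero    (suc k) = ℕ.*-zeroʳ (suc (suc k))
C-absorption (suc n) zero    =
  ≡.trans (ℕ.*-identityˡ _) (≡.trans (nC1≡n (suc (suc n))) (≡.sym (ℕ.*-identityʳ _)))
C-absorption (suc n) (suc k) = begin
  suc (suc k) ℕ.* (suc (suc n) choose suc (suc k))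
    ≡⟨ ≡.cong (suc (suc k) ℕ.*_) (nCk+nC[k+1]≡[n+1]C[k+1] (suc n) (suc k)) ⟨
  suc (suc k) ℕ.* (x ℕ.+ (suc n choose suc (suc k)))
    ≡⟨ ℕ.*-distribˡ-+ (suc (suc k)) x _ ⟩
  (x ℕ.+ suc k ℕ.* x) ℕ.+ suc (suc k) ℕ.* (suc n choose suc (suc k))
    ≡⟨ ≡.cong₂ (λ u v → (x ℕ.+ u) ℕ.+ v) (C-absorption n k) (C-absorption n (suc k)) ⟩
  (x ℕ.+ suc n ℕ.* (n choose k)) ℕ.+ suc n ℕ.* (n choose suc k)
    ≡⟨ ℕ.+-assoc x _ _ ⟩
  x ℕ.+ (suc n ℕ.* (n choose k) ℕ.+ suc n ℕ.* (n choose suc k))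
    ≡⟨ ≡.cong (x ℕ.+_) (ℕ.*-distribˡ-+ (suc n) (n choose k) _) ⟨
  x ℕ.+ suc n ℕ.* ((n choose k) ℕ.+ (n choose suc k))
    ≡⟨ ≡.cong (λ u → x ℕ.+ suc n ℕ.* u) (nCk+nC[k+1]≡[n+1]C[k+1] n k) ⟩
  x ℕ.+ suc n ℕ.* x ∎
  where
  open ≡.≡-Reasoning
  x = suc n choose suc k

-- Write x = α C(K+1, i+1) and y = β C(K, i). Absorption turns the hypothesis into x (i+1) = y (i+1)
-- + y r, so y ≤ x and γ = x - y is a genuine difference of naturals. The last equation has the
-- shape of the hypothesis again, with γ, y, exponent i + 1 and degree r, which is what lets the
-- induction in `power-coeff` continue.
binomial-weights : ∀ α β K i r → α ℕ.* suc K ≡ β ℕ.* suc (i ℕ.+ r) →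
  ∃[ γ ] (α ℕ.* (suc K choose suc i) ≡ γ ℕ.+ β ℕ.* (K choose i)) ∧ (γ ℕ.* suc i ≡ (β ℕ.* (K choose i)) ℕ.* r)
binomial-weights α β K i r αK≡βN = x ℕ.∸ y , ≡.sym (ℕ.m∸n+n≡m y≤x) ,
  (begin
    (x ℕ.∸ y) ℕ.* suc i              ≡⟨ ℕ.*-distribʳ-∸ (suc i) x y ⟩
    x ℕ.* suc i ℕ.∸ y ℕ.* suc i      ≡⟨ ≡.cong (ℕ._∸ y ℕ.* suc i) x[i+1]≡ ⟩
    (y ℕ.* suc i ℕ.+ y ℕ.* r) ℕ.∸ y ℕ.* suc i ≡⟨ ℕ.m+n∸m≡n (y ℕ.* suc i) (y ℕ.* r) ⟩
    y ℕ.* r                          ∎)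
  where
  open ≡.≡-Reasoning
  open +-*-Solver using (solve; _:*_; _:+_; _:=_)
  c = K choose i
  c′ = suc K choose suc i
  x = α ℕ.* c′
  y = β ℕ.* c
  x[i+1]≡ : x ℕ.* suc i ≡ y ℕ.* suc i ℕ.+ y ℕ.* r
  x[i+1]≡ = begin
    (α ℕ.* c′) ℕ.* suc i
      ≡⟨ solve 3 (λ α c i → (α :* c) :* i := α :* (i :* c)) ≡.refl α c′ (suc i) ⟩
    α ℕ.* (suc i ℕ.* c′)
      ≡⟨ ≡.cong (α ℕ.*_) (C-absorption K i) ⟩
    α ℕ.* (suc K ℕ.* c)
      ≡⟨ ℕ.*-assoc α (suc K) c ⟨
    (α ℕ.* suc K) ℕ.* c
      ≡⟨ ≡.cong (ℕ._* c) αK≡βN ⟩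
    (β ℕ.* (suc i ℕ.+ r)) ℕ.* c
      ≡⟨ solve 4 (λ β i r c → (β :* (i :+ r)) :* c := (β :* c) :* i :+ (β :* c) :* r) ≡.refl β (suc i) r c ⟩
    y ℕ.* suc i ℕ.+ y ℕ.* r ∎
  y≤x : y ℕ.≤ x
  y≤x = ℕ.*-cancelʳ-≤ y x (suc i) (≡.subst (y ℕ.* suc i ℕ.≤_) (≡.sym x[i+1]≡) (ℕ.m≤m+n _ _))

-- The Euler operator z d/dz and the coefficients of powers.

module EulerOperator {c ℓ : Level} (R : CommutativeRing c ℓ) where
  open CommutativeRing R hiding (zero)
  open Series R
  open PowerSeriesRing R
  open import Algebra.Properties.CommutativeMonoid.Mult +-commutativeMonoid using (×-distrib-+)
  open Mult semiring using (_×_; ×-congʳ; ×-congˡ; ×-homo-+; ×-assocˡ; ×-comm-*; ×-assoc-*)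
  open Exp commutativeSemiring using (_^_)
  open Sum semiring using (sum; sum-cong-≋)
  open import Relation.Binary.Reasoning.Setoid setoid

  module P = CommutativeRing powerSeriesRing
  open Mult P.semiring public using () renaming (_×_ to _×ᴾ_; ×-assoc-* to ×ᴾ-assoc-⊗)
  open Exp P.commutativeSemiring public using ()
    renaming (_^_ to _^ᴾ_; ^-congˡ to ^ᴾ-congˡ; ^-distrib-* to ^ᴾ-distrib-⊗)
  open Sum P.semiring using () renaming (sum to sumᴾ; *-distribʳ-sum to ⊗-distribʳ-sum)
  open import Algebra.Properties.CommutativeSemiring.Binomial P.commutativeSemiring
    using (binomialTerm) renaming (theorem to binomial-theorem)
  open import Algebra.Solver.Ring.NaturalCoefficients.Default P.commutativeSemiring
    using (solve; _:*_; _:+_; _:=_)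

  ×-zero : ∀ n → n × 0# ≈ 0#
  ×-zero zero    = refl
  ×-zero (suc n) = trans (+-identityˡ _) (×-zero n)

  coeff-×ᴾ : ∀ n a k → (n ×ᴾ a) k ≡ n × a k
  coeff-×ᴾ zero    a k = ≡.refl
  coeff-×ᴾ (suc n) a k = ≡.cong (λ x → a k + x) (coeff-×ᴾ n a k)

  coeff-sumᴾ : ∀ {n} (a : Fin n → PS) k → sumᴾ a k ≡ sum (λ i → a i k)
  coeff-sumᴾ {zero}  a k = ≡.refl
  coeff-sumᴾ {suc n} a k = ≡.cong (λ x → a zero k + x) (coeff-sumᴾ (λ i → a (suc i)) k)

  ×-sum : ∀ m {n} (a : Fin n → Carrier) → m × sum a ≈ sum (λ i → m × a i)
  ×-sum m {zero}  a = ×-zero m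
  ×-sum m {suc n} a = trans (×-distrib-+ _ _ m) (+-congˡ (×-sum m (λ i → a (suc i))))

  const-^ : ∀ x n → const x ^ᴾ n ≋ const (x ^ n)
  const-^ x zero    = onePS≋const
  const-^ x (suc n) k = begin
    (const x ⊗ (const x ^ᴾ n)) k ≈⟨ const⊗ x (const x ^ᴾ n) k ⟩
    x * (const x ^ᴾ n) k         ≈⟨ *-congˡ (const-^ x n k) ⟩
    x * const (x ^ n) k          ≈⟨ x*const k ⟩
    const (x ^ suc n) k          ∎
    where
    x*const : ∀ k → x * const (x ^ n) k ≈ const (x ^ suc n) k
    x*const zero    = refl
    x*const (suc k) = zeroʳ x

  z⊗-zero : ∀ a → (zPS ⊗ a) 0 ≈ 0#
  z⊗-zero a = zeroˡ _

  z⊗-suc : ∀ a k → (zPS ⊗ a) (suc k) ≈ a k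
  z⊗-suc a k = begin
    (zPS ⊗ a) (suc k)                         ≈⟨ ⊗-suc zPS a k ⟩
    0# * a (suc k) + (tail zPS ⊗ a) k         ≈⟨ +-cong (zeroˡ _) (⊗-cong {b = a} tail-z (λ _ → refl) k) ⟩
    0# + (onePS ⊗ a) k                        ≈⟨ +-identityˡ _ ⟩
    (onePS ⊗ a) k                             ≈⟨ ⊗-identityˡ a k ⟩
    a k                                       ∎
    where
    tail-z : tail zPS ≋ onePS
    tail-z zero    = refl
    tail-z (suc _) = refl

  z^⊗-+ : ∀ j a k → ((zPS ^ᴾ j) ⊗ a) (j ℕ.+ k) ≈ a k
  z^⊗-+ zero    a k = ⊗-identityˡ a k
  z^⊗-+ (suc j) a k = begin
    ((zPS ⊗ (zPS ^ᴾ j)) ⊗ a) (suc (j ℕ.+ k))  ≈⟨ ⊗-assoc zPS (zPS ^ᴾ j) a (suc (j ℕ.+ k)) ⟩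
    (zPS ⊗ ((zPS ^ᴾ j) ⊗ a)) (suc (j ℕ.+ k))  ≈⟨ z⊗-suc ((zPS ^ᴾ j) ⊗ a) (j ℕ.+ k) ⟩
    ((zPS ^ᴾ j) ⊗ a) (j ℕ.+ k)                ≈⟨ z^⊗-+ j a k ⟩
    a k                                       ∎

  z^⊗-< : ∀ {j k} a → k ℕ.< j → ((zPS ^ᴾ j) ⊗ a) k ≈ 0#
  z^⊗-< {suc j} {zero}  a _         = trans (⊗-assoc zPS (zPS ^ᴾ j) a 0) (z⊗-zero ((zPS ^ᴾ j) ⊗ a))
  z^⊗-< {suc j} {suc k} a (s≤s k<j) = begin
    ((zPS ⊗ (zPS ^ᴾ j)) ⊗ a) (suc k)  ≈⟨ ⊗-assoc zPS (zPS ^ᴾ j) a (suc k) ⟩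
    (zPS ⊗ ((zPS ^ᴾ j) ⊗ a)) (suc k)  ≈⟨ z⊗-suc ((zPS ^ᴾ j) ⊗ a) k ⟩
    ((zPS ^ᴾ j) ⊗ a) k                ≈⟨ z^⊗-< a k<j ⟩
    0#                                ∎

  head⊕tail : ∀ a → a ≋ (zPS ⊗ tail a) ⊕ const (a 0)
  head⊕tail a zero    = sym (trans (+-congʳ (z⊗-zero (tail a))) (+-identityˡ _))
  head⊕tail a (suc k) = sym (trans (+-identityʳ _) (z⊗-suc (tail a) k))

  euler : PS → PS
  euler a k = k × a k

  -- The weight k of a product of terms in degrees i and k - i splits as i + (k - i).
  euler-⊗ : ∀ a b → euler (a ⊗ b) ≋ (euler a ⊗ b) ⊕ (a ⊗ euler b)
  euler-⊗ a b k = begin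
    k × Σ≤ k (λ i → a i * b (k ℕ.∸ i))
      ≈⟨ ×-Σ≤ k ⟩
    Σ≤ k (λ i → k × (a i * b (k ℕ.∸ i)))
      ≈⟨ Σ≤-cong-≤ k term ⟩
    Σ≤ k ((λ i → euler a i * b (k ℕ.∸ i)) ⊕ (λ i → a i * euler b (k ℕ.∸ i)))
      ≈⟨ Σ≤-+ k _ _ ⟩
    (euler a ⊗ b) k + (a ⊗ euler b) k ∎
    where
    ×-Σ≤ : ∀ n {f : PS} → k × Σ≤ n f ≈ Σ≤ n (λ i → k × f i)
    ×-Σ≤ zero    = refl
    ×-Σ≤ (suc n) = trans (×-distrib-+ _ _ k) (+-congʳ (×-Σ≤ n))

    term : ∀ i → i ℕ.≤ k → k × (a i * b (k ℕ.∸ i)) ≈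
      euler a i * b (k ℕ.∸ i) + a i * euler b (k ℕ.∸ i)
    term i i≤k = begin
      k × x                            ≈⟨ ×-congˡ {x} (ℕ.m+[n∸m]≡n i≤k) ⟨
      (i ℕ.+ (k ℕ.∸ i)) × x            ≈⟨ ×-homo-+ x i (k ℕ.∸ i) ⟩
      i × x + (k ℕ.∸ i) × x            ≈⟨ +-cong (×-assoc-* i _ _) (×-comm-* (k ℕ.∸ i) _ _) ⟨
      (i × a i) * b (k ℕ.∸ i) + a i * ((k ℕ.∸ i) × b (k ℕ.∸ i)) ∎
      where x = a i * b (k ℕ.∸ i)

  eulerDerivation : Derivation powerSeriesRing
  eulerDerivation = record
    { θ      = euler
    ; θ-cong = λ a≋b k → ×-congʳ k (a≋b k)
    ; θ-+    = λ a b k → ×-distrib-+ (a k) (b k) k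
    ; θ-*    = euler-⊗
    }

  open Derivation eulerDerivation

  θ-z : θ zPS ≋ zPS
  θ-z zero          = refl
  θ-z (suc zero)    = +-identityʳ 1#
  θ-z (suc (suc k)) = ×-zero (suc (suc k))

  -- The constant coefficient drops out, and the weight k + 1 of the next ones splits as 1 + k.
  θ-tail : ∀ a → θ a ≋ zPS ⊗ (tail a ⊕ θ (tail a))
  θ-tail a zero    = sym (z⊗-zero (tail a ⊕ θ (tail a)))
  θ-tail a (suc k) = sym (z⊗-suc (tail a ⊕ θ (tail a)) k)

  -- Up to a factor K+1 this is θ(h^(K+1)) = (K+1) h^K θh. To avoid cancelling it, write
  -- h = h₀ + z b, expand both sides binomially and compare the terms in h₀^(K−i) z^(i+1): with
  -- the weights of `binomial-weights` each comparison is the same statement for b at N − i − 1.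
  power-coeff : ∀ h N K α β → α ℕ.* suc K ≡ β ℕ.* N →
    α × (h ^ᴾ suc K) N ≈ β × ((h ^ᴾ K) ⊗ θ h) N
  power-coeff h N = go h N N ℕ.≤-refl
    where
    -- The bound `B` is what decreases: the recursive call concerns `tail h` in a degree r known
    -- only to satisfy r ≤ N - 1, which is not a structural subterm.
    go : ∀ h B N → N ℕ.≤ B → ∀ K α β → α ℕ.* suc K ≡ β ℕ.* N →
      α × (h ^ᴾ suc K) N ≈ β × ((h ^ᴾ K) ⊗ θ h) N
    go h B zero _ K α β αK≡0
      -- In degree 0 the hypothesis forces α = 0, and `θ h` has zero constant coefficient, so both
      -- sides vanish.
      rewrite ℕ.m*n≡0⇒m≡0 α (suc K) (≡.trans αK≡0 (ℕ.*-zeroʳ β)) =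
      sym (trans (×-congʳ β (zeroʳ _)) (×-zero β))
    go h (suc B) (suc N) (s≤s N≤B) K α β αK≡βN = begin
      α × (h ^ᴾ suc K) (suc N)
        ≈⟨ ×-congʳ α (^ᴾ-congˡ (suc K) (head⊕tail h) (suc N)) ⟩
      α × ((x ⊕ y) ^ᴾ suc K) (suc N)
        ≈⟨ ×-congʳ α (binomial-theorem (suc K) x y (suc N)) ⟩
      α × sumᴾ (binomialTerm x y (suc K)) (suc N)
        ≈⟨ ×-congʳ α (reflexive (coeff-sumᴾ (binomialTerm x y (suc K)) (suc N))) ⟩
      α × (binomialTerm x y (suc K) zero (suc N) +
           sum (λ i → binomialTerm x y (suc K) (suc i) (suc N)))
        -- The term without `x` is a power of a constant, absent in positive degree. Term i + 1 of
        -- the (K+1)-st power is then matched with term i of the K-th power times `θ h`, which is z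
        -- `u`.
        ≈⟨ ×-congʳ α (trans (+-congʳ first-term) (+-identityˡ _)) ⟩
      α × sum (λ i → binomialTerm x y (suc K) (suc i) (suc N))
        ≈⟨ ×-sum α (λ i → binomialTerm x y (suc K) (suc i) (suc N)) ⟩
      sum (λ i → α × binomialTerm x y (suc K) (suc i) (suc N))
        ≈⟨ sum-cong-≋ term ⟩
      sum (λ i → β × (binomialTerm x y K i ⊗ (zPS ⊗ u)) (suc N))
        ≈⟨ ×-sum β (λ i → (binomialTerm x y K i ⊗ (zPS ⊗ u)) (suc N)) ⟨
      β × sum (λ i → (binomialTerm x y K i ⊗ (zPS ⊗ u)) (suc N))
        ≈⟨ ×-congʳ β (reflexive (coeff-sumᴾ (λ i → binomialTerm x y K i ⊗ (zPS ⊗ u)) (suc N))) ⟨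
      β × sumᴾ (λ i → binomialTerm x y K i ⊗ (zPS ⊗ u)) (suc N)
        ≈⟨ ×-congʳ β (⊗-distribʳ-sum (zPS ⊗ u) (binomialTerm x y K) (suc N)) ⟨
      β × (sumᴾ (binomialTerm x y K) ⊗ (zPS ⊗ u)) (suc N)
        ≈⟨ ×-congʳ β (⊗-cong
             (λ k → sym (trans (^ᴾ-congˡ K (head⊕tail h) k) (binomial-theorem K x y k)))
             (λ k → sym (θ-tail h k)) (suc N)) ⟩
      β × ((h ^ᴾ K) ⊗ θ h) (suc N) ∎
      where
      a = h 0
      b = tail h
      x = zPS ⊗ b
      y = const a
      u = b ⊕ θ b

      first-term : binomialTerm x y (suc K) zero (suc N) ≈ 0#
      first-term = begin
        (1 ×ᴾ (onePS ⊗ (y ^ᴾ suc K))) (suc N)  ≈⟨ +-identityʳ _ ⟩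
        (onePS ⊗ (y ^ᴾ suc K)) (suc N)         ≈⟨ ⊗-identityˡ (y ^ᴾ suc K) (suc N) ⟩
        (y ^ᴾ suc K) (suc N)                   ≈⟨ const-^ a (suc K) (suc N) ⟩
        0#                                     ∎

      core : ∀ i → i ℕ.≤ N ⊎ N ℕ.< i →
        (α ℕ.* (suc K choose suc i)) × ((zPS ^ᴾ suc i) ⊗ (b ^ᴾ suc i)) (suc N) ≈
        (β ℕ.* (K choose i)) × ((zPS ^ᴾ suc i) ⊗ ((b ^ᴾ suc i) ⊕ ((b ^ᴾ i) ⊗ θ b))) (suc N)
      core i (inj₂ N<i) = begin
        m × ((zPS ^ᴾ suc i) ⊗ (b ^ᴾ suc i)) (suc N) ≈⟨ ×-congʳ m (z^⊗-< (b ^ᴾ suc i) (s≤s N<i)) ⟩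
        m × 0#                                      ≈⟨ ×-zero m ⟩
        0#                                          ≈⟨ ×-zero n ⟨
        n × 0#                                      ≈⟨ ×-congʳ n (z^⊗-< ((b ^ᴾ suc i) ⊕ ((b ^ᴾ i) ⊗ θ b)) (s≤s N<i)) ⟨
        n × ((zPS ^ᴾ suc i) ⊗ ((b ^ᴾ suc i) ⊕ ((b ^ᴾ i) ⊗ θ b))) (suc N) ∎
        where
        m = α ℕ.* (suc K choose suc i)
        n = β ℕ.* (K choose i)
      core i (inj₁ i≤N) with ℕ.m≤n⇒∃[o]m+o≡n i≤N
      ... | r , ≡.refl with binomial-weights α β K i r αK≡βN
      -- Removing z^(i+1) leaves degree r. The part n of the weight m yields the summand b^(i+1);
      -- the surplus γ is converted by the induction hypothesis for `b` into n times b^i θb.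
      ... | γ , m≡γ+n , γi≡nr = begin
        m × ((zPS ^ᴾ suc i) ⊗ (b ^ᴾ suc i)) (suc i ℕ.+ r) ≈⟨ ×-congʳ m (z^⊗-+ (suc i) (b ^ᴾ suc i) r) ⟩
        m × (b ^ᴾ suc i) r                        ≈⟨ ×-congˡ m≡γ+n ⟩
        (γ ℕ.+ n) × (b ^ᴾ suc i) r                ≈⟨ ×-homo-+ _ γ n ⟩
        γ × (b ^ᴾ suc i) r + n × (b ^ᴾ suc i) r   ≈⟨ +-congʳ (go b B r (ℕ.≤-trans (ℕ.m≤n+m r i) N≤B) i γ n γi≡nr) ⟩
        n × ((b ^ᴾ i) ⊗ θ b) r + n × (b ^ᴾ suc i) r ≈⟨ +-comm _ _ ⟩
        n × (b ^ᴾ suc i) r + n × ((b ^ᴾ i) ⊗ θ b) r ≈⟨ ×-distrib-+ _ _ n ⟨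
        n × ((b ^ᴾ suc i) r + ((b ^ᴾ i) ⊗ θ b) r)   ≈⟨ ×-congʳ n (z^⊗-+ (suc i) ((b ^ᴾ suc i) ⊕ ((b ^ᴾ i) ⊗ θ b)) r) ⟨
        n × ((zPS ^ᴾ suc i) ⊗ ((b ^ᴾ suc i) ⊕ ((b ^ᴾ i) ⊗ θ b))) (suc i ℕ.+ r) ∎
        where
        m = α ℕ.* (suc K choose suc i)
        n = β ℕ.* (K choose i)

      scaled : ∀ i j γ c f {g} → g ≋ (y ^ᴾ j) ⊗ ((zPS ^ᴾ suc i) ⊗ f) →
        γ × (c ×ᴾ g) (suc N) ≈ a ^ j * ((γ ℕ.* c) × ((zPS ^ᴾ suc i) ⊗ f) (suc N))
      scaled i j γ c f {g} g≋ = begin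
        γ × (c ×ᴾ g) (suc N)       ≡⟨ ≡.cong (γ ×_) (coeff-×ᴾ c g (suc N)) ⟩
        γ × (c × g (suc N))        ≈⟨ ×-assocˡ _ γ c ⟩
        (γ ℕ.* c) × g (suc N)      ≈⟨ ×-congʳ (γ ℕ.* c) (g≋ (suc N)) ⟩
        (γ ℕ.* c) × ((y ^ᴾ j) ⊗ v) (suc N)        ≈⟨ ×-congʳ (γ ℕ.* c) (⊗-cong {b = v} (const-^ a j) (λ _ → refl) (suc N)) ⟩
        (γ ℕ.* c) × (const (a ^ j) ⊗ v) (suc N)   ≈⟨ ×-congʳ (γ ℕ.* c) (const⊗ (a ^ j) v (suc N)) ⟩
        (γ ℕ.* c) × (a ^ j * v (suc N))           ≈⟨ ×-comm-* (γ ℕ.* c) _ _ ⟨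
        a ^ j * ((γ ℕ.* c) × v (suc N))           ∎
        where v = (zPS ^ᴾ suc i) ⊗ f

      -- Both terms contain y^(K-i), since (K+1) - (i+1) reduces to K - i. Once `scaled` has
      -- extracted this common scalar, only the comparison in `core` is left.
      term : ∀ (i : Fin (suc K)) →
        α × binomialTerm x y (suc K) (suc i) (suc N) ≈
        β × (binomialTerm x y K i ⊗ (zPS ⊗ u)) (suc N)
      term i′ = begin
        α × ((suc K choose suc i) ×ᴾ ((x ^ᴾ suc i) ⊗ (y ^ᴾ j))) (suc N)
          ≈⟨ scaled i j α (suc K choose suc i) (b ^ᴾ suc i)
               (P.trans (P.*-comm (x ^ᴾ suc i) (y ^ᴾ j)) (P.*-congˡ {y ^ᴾ j} (^ᴾ-distrib-⊗ zPS b (suc i)))) ⟩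
        a ^ j * ((α ℕ.* (suc K choose suc i)) × ((zPS ^ᴾ suc i) ⊗ (b ^ᴾ suc i)) (suc N))
          ≈⟨ *-congˡ (core i (ℕ.≤-<-connex i N)) ⟩
        a ^ j * ((β ℕ.* (K choose i)) × ((zPS ^ᴾ suc i) ⊗ ((b ^ᴾ suc i) ⊕ ((b ^ᴾ i) ⊗ θ b))) (suc N))
          ≈⟨ scaled i j β (K choose i) ((b ^ᴾ suc i) ⊕ ((b ^ᴾ i) ⊗ θ b)) regroup ⟨
        β × ((K choose i) ×ᴾ (((x ^ᴾ i) ⊗ (y ^ᴾ j)) ⊗ (zPS ⊗ u))) (suc N)
          ≈⟨ ×-congʳ β (×ᴾ-assoc-⊗ (K choose i) ((x ^ᴾ i) ⊗ (y ^ᴾ j)) (zPS ⊗ u) (suc N)) ⟨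
        β × (((K choose i) ×ᴾ ((x ^ᴾ i) ⊗ (y ^ᴾ j))) ⊗ (zPS ⊗ u)) (suc N) ∎
        where
        i = toℕ i′
        j = K ℕ.∸ i
        regroup : ((x ^ᴾ i) ⊗ (y ^ᴾ j)) ⊗ (zPS ⊗ u) ≋
          (y ^ᴾ j) ⊗ ((zPS ^ᴾ suc i) ⊗ ((b ^ᴾ suc i) ⊕ ((b ^ᴾ i) ⊗ θ b)))
        regroup = P.trans
          (P.*-congʳ {zPS ⊗ u} (P.*-congʳ {y ^ᴾ j} (^ᴾ-distrib-⊗ zPS b i)))
          (solve 6 (λ zⁱ bⁱ yʲ z b t →
             ((zⁱ :* bⁱ) :* yʲ) :* (z :* (b :+ t)) := yʲ :* ((z :* zⁱ) :* (b :* bⁱ :+ bⁱ :* t)))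
             (λ _ → refl) (zPS ^ᴾ i) (b ^ᴾ i) (y ^ᴾ j) zPS b (θ b))

-- Lagrange inversion and the cumulant formula.

module LagrangeInversion {c ℓ : Level} (R : CommutativeRing c ℓ) where
  open CommutativeRing R hiding (zero)
  open Series R
  open PowerSeriesRing R
  open EulerOperator R
  open Derivation eulerDerivation
  open import Algebra.Properties.CommutativeMonoid.Mult +-commutativeMonoid using (×-distrib-+)
  open import Algebra.Properties.Group +-group using (ε⁻¹≈ε)
  open import Algebra.Properties.Ring P.ring using () renaming (-‿distribˡ-* to -‿distribˡ-⊗)
  open Mult semiring using (_×_; ×-congʳ; ×-comm-*)
  open import Algebra.Solver.Ring.NaturalCoefficients.Default P.commutativeSemiring
    using (solve; _:*_; _:=_)
  open import Relation.Binary.Reasoning.Setoid setoid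

  ^ps≡^ᴾ : ∀ a n → a ^ps n ≡ a ^ᴾ n
  ^ps≡^ᴾ a zero    = ≡.refl
  ^ps≡^ᴾ a (suc n) = ≡.cong (a ⊗_) (^ps≡^ᴾ a n)

  ·≡× : ∀ n x → n · x ≡ n × x
  ·≡× zero    x = ≡.refl
  ·≡× (suc n) x = ≡.cong (λ y → x + y) (·≡× n x)

  module _ {g h : PS} (gh≋1 : g ⊗ h ≋ onePS) where

    residue-zero : ((h ^ᴾ 0) ⊕ (θ g ⊗ (h ^ᴾ 1))) 0 ≈ 1#
    residue-zero = trans (+-congˡ (zeroˡ _)) (+-identityʳ 1#)

    -- By `θ-inverse`, θg h² = -θh, so the second summand is -h^K θh. In degree K + 1 it cancels the
    -- first by `power-coeff` with both weights equal to 1. Over the rationals this is the vanishing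
    -- residue of the derivative of a negative power of z g.
    residue-suc : ∀ K → ((h ^ᴾ suc K) ⊕ (θ g ⊗ (h ^ᴾ suc (suc K)))) (suc K) ≈ 0#
    residue-suc K = begin
      (h ^ᴾ suc K) (suc K) + (θ g ⊗ (h ^ᴾ suc (suc K))) (suc K)
        ≈⟨ +-cong h^K≈ (θg≋ (suc K)) ⟩
      ((h ^ᴾ K) ⊗ θ h) (suc K) + - ((h ^ᴾ K) ⊗ θ h) (suc K)
        ≈⟨ -‿inverseʳ _ ⟩
      0# ∎
      where
      h^K≈ : (h ^ᴾ suc K) (suc K) ≈ ((h ^ᴾ K) ⊗ θ h) (suc K)
      h^K≈ = trans (sym (+-identityʳ _)) (trans (power-coeff h (suc K) K 1 1 ≡.refl) (+-identityʳ _))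

      θg≋ : θ g ⊗ (h ^ᴾ suc (suc K)) ≋ P.- ((h ^ᴾ K) ⊗ θ h)
      θg≋ = P.trans {θ g ⊗ (h ^ᴾ suc (suc K))} {(θ g ⊗ (h ⊗ h)) ⊗ (h ^ᴾ K)} {P.- ((h ^ᴾ K) ⊗ θ h)}
        (solve 3 (λ t h hᴷ → t :* (h :* (h :* hᴷ)) := (t :* (h :* h)) :* hᴷ) (λ _ → refl) (θ g) h (h ^ᴾ K))
        (P.trans {_} {(P.- θ h) ⊗ (h ^ᴾ K)} {P.- ((h ^ᴾ K) ⊗ θ h)}
          (P.*-congʳ {h ^ᴾ K} (θ-inverse {g} {h} gh≋1))
          (P.trans {_} {P.- (θ h ⊗ (h ^ᴾ K))}
            (P.sym {P.- (θ h ⊗ (h ^ᴾ K))} (-‿distribˡ-⊗ (θ h) (h ^ᴾ K)))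
            (P.-‿cong {θ h ⊗ (h ^ᴾ K)} {(h ^ᴾ K) ⊗ θ h} (⊗-comm (θ h) (h ^ᴾ K)))))

    quotient-coeff : ∀ i r → (θ ((zPS ⊗ g) ^ᴾ suc i) ⊗ (h ^ᴾ (suc i ℕ.+ r))) (suc i ℕ.+ r) ≈
      suc i × ((h ^ᴾ r) ⊕ (θ g ⊗ (h ^ᴾ suc r))) r
    quotient-coeff i r = begin
      (θ ((zPS ⊗ g) ^ᴾ suc i) ⊗ (h ^ᴾ m)) m
        ≈⟨ θ-power-quotient {zPS} θ-z {g} {h} gh≋1 i r m ⟩
      (suc i ×ᴾ ((zPS ^ᴾ suc i) ⊗ f)) m
        ≡⟨ coeff-×ᴾ (suc i) ((zPS ^ᴾ suc i) ⊗ f) m ⟩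
      suc i × ((zPS ^ᴾ suc i) ⊗ f) m
        ≈⟨ ×-congʳ (suc i) (z^⊗-+ (suc i) f r) ⟩
      suc i × f r ∎
      where
      m = suc i ℕ.+ r
      f = (h ^ᴾ r) ⊕ (θ g ⊗ (h ^ᴾ suc r))

    -- Together with `quotient-coeff-≡` this shows that, for m ≥ 1, the functional sending F to
    -- [z^m] θF h^m isolates m times the coefficient of (z g)^m in a combination of the powers (z
    -- g)^j, j ≤ m.
    quotient-coeff-< : ∀ {j m} → j ℕ.< m → (θ ((zPS ⊗ g) ^ᴾ j) ⊗ (h ^ᴾ m)) m ≈ 0#
    quotient-coeff-< {zero}  {m} _ = begin
      (θ onePS ⊗ (h ^ᴾ m)) m     ≈⟨ ⊗-cong {b = h ^ᴾ m} θ-1# (λ _ → refl) m ⟩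
      ((λ _ → 0#) ⊗ (h ^ᴾ m)) m  ≈⟨ P.zeroˡ (h ^ᴾ m) m ⟩
      0#                         ∎
    quotient-coeff-< {suc i} i<m with ℕ.m≤n⇒∃[o]m+o≡n i<m
    -- Here j < m makes the remaining degree r = m - j equal to K + 1, so `residue-suc` applies.
    ... | K , i+1+K≡m = ≡.subst (λ m → (θ ((zPS ⊗ g) ^ᴾ suc i) ⊗ (h ^ᴾ m)) m ≈ 0#)
      (≡.trans (ℕ.+-suc (suc i) K) i+1+K≡m)
      (trans (quotient-coeff i (suc K)) (trans (×-congʳ (suc i) (residue-suc K)) (×-zero (suc i))))

    quotient-coeff-≡ : ∀ i → (θ ((zPS ⊗ g) ^ᴾ suc i) ⊗ (h ^ᴾ suc i)) (suc i) ≈ suc i × 1#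
    quotient-coeff-≡ i = ≡.subst (λ m → (θ ((zPS ⊗ g) ^ᴾ suc i) ⊗ (h ^ᴾ m)) m ≈ suc i × 1#)
      (ℕ.+-identityʳ (suc i)) (trans (quotient-coeff i 0) (×-congʳ (suc i) residue-zero))

  -- The sum defining `∘ps` has an upper bound that moves with the degree. Fixing it at `n` gives a
  -- finite combination of series, on which `θ` and products act term by term.
  combination : ℕ → PS → (ℕ → PS) → PS
  combination n f F k = Σ≤ n (λ j → f j * F j k)

  θ-combination : ∀ n f F → θ (combination n f F) ≋ combination n f (λ j → θ (F j))
  θ-combination zero    f F k = sym (×-comm-* k _ _)
  θ-combination (suc n) f F k =
    trans (×-distrib-+ _ _ k) (+-cong (θ-combination n f F k) (sym (×-comm-* k _ _)))

  combination-⊗ : ∀ n f F b → combination n f F ⊗ b ≋ combination n f (λ j → F j ⊗ b)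
  combination-⊗ zero    f F b k = scale-⊗ (f 0) (F 0) b k
  combination-⊗ (suc n) f F b k = trans
    (⊗-distribʳ b (combination n f F) (λ i → f (suc n) * F (suc n) i) k)
    (+-cong (combination-⊗ n f F b k) (scale-⊗ (f (suc n)) (F (suc n)) b k))

  -- (z g)^j is divisible by z^j, so the terms with j > k contribute nothing in degree k and the sum
  -- extends to any bound `n` from k on.
  ∘ps-truncate : ∀ f {g G} → G ≋ zPS ⊗ g → ∀ {k n} → k ℕ.≤ n →
    (f ∘ps G) k ≈ combination n f (λ j → (zPS ⊗ g) ^ᴾ j) k
  ∘ps-truncate f {g} {G} G≋zg {k} {n} k≤n = begin
    Σ≤ k (λ j → f j * (G ^ps j) k)
      ≈⟨ Σ≤-cong k (λ j → *-congˡ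
           (trans (reflexive (≡.cong (λ a → a k) (^ps≡^ᴾ G j))) (^ᴾ-congˡ j G≋zg k))) ⟩
    Σ≤ k (λ j → f j * ((zPS ⊗ g) ^ᴾ j) k)
      ≈⟨ Σ≤-extend k≤n (λ j k<j → trans
           (*-congˡ (trans (^ᴾ-distrib-⊗ zPS g j k) (z^⊗-< (g ^ᴾ j) k<j))) (zeroʳ (f j))) ⟩
    Σ≤ n (λ j → f j * ((zPS ⊗ g) ^ᴾ j) k) ∎

  -- Only degrees up to m = i + 1 of the composition matter, so it may be truncated at j = m; of the
  -- resulting terms only j = m survives.
  lagrange : ∀ f {g h G} → g ⊗ h ≋ onePS → G ≋ zPS ⊗ g → ∀ i →
    (θ (f ∘ps G) ⊗ (h ^ᴾ suc i)) (suc i) ≈ suc i × f (suc i)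
  lagrange f {g} {h} {G} gh≋1 G≋zg i = begin
    (θ (f ∘ps G) ⊗ H) m
      ≈⟨ ⊗-cong-≤ m {b = H}
           (λ k k≤m → trans (×-congʳ k (∘ps-truncate f {g} {G} G≋zg k≤m)) (θ-combination m f F k))
           (λ _ → refl) ⟩
    (combination m f (λ j → θ (F j)) ⊗ H) m
      ≈⟨ combination-⊗ m f (λ j → θ (F j)) H m ⟩
    Σ≤ i (λ j → f j * (θ (F j) ⊗ H) m) + f m * (θ (F m) ⊗ H) m
      ≈⟨ +-cong (Σ≤-zero i λ j j≤i →
                   trans (*-congˡ (quotient-coeff-< {g} {h} gh≋1 (s≤s j≤i))) (zeroʳ (f j)))
                (*-congˡ (quotient-coeff-≡ {g} {h} gh≋1 i)) ⟩
    0# + f m * (m × 1#)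
      ≈⟨ +-identityˡ _ ⟩
    f m * (m × 1#)
      ≈⟨ ×-comm-* m (f m) 1# ⟩
    m × (f m * 1#)
      ≈⟨ ×-congʳ m (*-identityʳ (f m)) ⟩
    m × f m ∎
    where
    m = suc i
    H = h ^ᴾ m
    F : ℕ → PS
    F j = (zPS ⊗ g) ^ᴾ j

  coeff-offset : ∀ v a k i → k ℤ.- v ≡ + i → coeff (v , a) k ≡ a i
  coeff-offset v a k i k-v≡i with k ℤ.- v | k-v≡i
  ... | _ | ≡.refl = ≡.refl

  ^L-offset1 : ∀ a j → (+ 1 , a) ^L j ≡ (+ j , a ^ps j)
  ^L-offset1 a zero    = ≡.refl
  ^L-offset1 a (suc j) = ≡.cong ((+ 1 , a) *L_) (^L-offset1 a j)

  cumulant-formula : (C δ M : ℕ → Carrier) → δ 0 ≈ 1# →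
    (∀ k → shift1 M k ≈ (zPS ⊗ inv (onePS ⊖ (zPS ⊗ (Cser C ∘ps (shift1 M ⊙ shift1 δ))))) k) →
    ∀ i → suc i · C (suc (suc i)) ≈
         coeff ((((fromPS (deriv (shift1 M)) /L (fromPS₁ (shift1 M) ^L 2)) -L zpow -[1+ 1 ])
                 /L (fromPS₁ (shift1 M ⊙ shift1 δ) ^L suc i)))
               -[1+ 0 ]
  cumulant-formula C δ M δ₀≈1 eq i = sym (begin
    coeff (N /L ((+ 1 , g) ^L m)) -[1+ 0 ]
      ≡⟨ ≡.cong (λ x → coeff (N /L x) -[1+ 0 ]) (^L-offset1 g m) ⟩
    coeff (N /L (+ m , g ^ps m)) -[1+ 0 ]
      -- The numerator has offset -2 and the denominator offset m, so the quotient has offset -(m +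
      -- 2) and z^(-1) sits at index m + 1. The factor z in `Y≋zθE` then lowers this to m.
      ≡⟨ coeff-offset -[1+ suc (suc i) ] (Y ⊗ inv (g ^ps m)) -[1+ 0 ] (suc m) ≡.refl ⟩
    (Y ⊗ inv (g ^ps m)) (suc m)
      ≈⟨ ⊗-cong Y≋zθE inv-g^m (suc m) ⟩
    ((zPS ⊗ θ E) ⊗ (h ^ᴾ m)) (suc m)
      ≈⟨ ⊗-assoc zPS (θ E) (h ^ᴾ m) (suc m) ⟩
    (zPS ⊗ (θ E ⊗ (h ^ᴾ m))) (suc m)
      ≈⟨ z⊗-suc (θ E ⊗ (h ^ᴾ m)) m ⟩
    (θ E ⊗ (h ^ᴾ m)) m
      ≈⟨ lagrange (Cser C) {g} {h} {G} gh≋1 G≋zg i ⟩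
    m × C (suc m)
      ≡⟨ ·≡× m (C (suc m)) ⟨
    m · C (suc m) ∎)
    where
    m = suc i
    G = shift1 M ⊙ shift1 δ
    g = tail G
    h = inv g
    E = Cser C ∘ps G
    D = onePS ⊖ (zPS ⊗ E)
    X = deriv (shift1 M) ⊗ inv (M ⊗ (M ⊗ onePS))
    -- Both M̂′/M̂² and z^(-2) are represented with offset -2, so their difference is too; `Y` is
    -- the coefficient sequence that `_-L_` produces for it.
    Y : PS
    Y k = coeff (-[1+ 1 ] , X) (-[1+ 1 ] ℤ.+ + k)
        + coeff (-[1+ 1 ] , λ j → - onePS j) (-[1+ 1 ] ℤ.+ + k)
    N : LS
    N = -[1+ 1 ] , Y

    D₀≈1 : D 0 ≈ 1#
    D₀≈1 = trans (+-congˡ (trans (-‿cong (z⊗-zero E)) ε⁻¹≈ε)) (+-identityʳ 1#)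

    M≋invD : M ≋ inv D
    M≋invD k = trans (eq (suc k)) (z⊗-suc (inv D) k)

    MD≋1 : M ⊗ D ≋ onePS
    MD≋1 k = trans (⊗-cong {b = D} M≋invD (λ _ → refl) k) (trans (⊗-comm (inv D) D k) (⊗-inv D D₀≈1 k))

    D⊕zE≋1 : D ⊕ (zPS ⊗ E) ≋ onePS
    D⊕zE≋1 k = trans (+-assoc _ _ _) (trans (+-congˡ (-‿inverseˡ _)) (+-identityʳ _))

    G≋zg : G ≋ zPS ⊗ g
    G≋zg zero    = trans (zeroˡ _) (sym (z⊗-zero g))
    G≋zg (suc k) = sym (z⊗-suc g k)

    M₀≈1 : M 0 ≈ 1#
    M₀≈1 = M≋invD 0

    g₀≈1 : g 0 ≈ 1#
    g₀≈1 = trans (*-cong M₀≈1 δ₀≈1) (*-identityʳ 1#)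

    gh≋1 : g ⊗ h ≋ onePS
    gh≋1 = ⊗-inv g g₀≈1

    inv-g^m : inv (g ^ps m) ≋ h ^ᴾ m
    inv-g^m = ≡.subst (λ a → inv a ≋ h ^ᴾ m) (≡.sym (^ps≡^ᴾ g m))
      (inv-unique (g ^ᴾ m) (h ^ᴾ m) (^-const m) (^-inverse {g} {h} gh≋1 m))
      where
      ^-const : ∀ n → (g ^ᴾ n) 0 ≈ 1#
      ^-const zero    = refl
      ^-const (suc n) = trans (*-cong g₀≈1 (^-const n)) (*-identityʳ 1#)

    inv-M² : inv (M ⊗ (M ⊗ onePS)) ≋ D ⊗ D
    inv-M² = inv-unique (M ⊗ (M ⊗ onePS)) (D ⊗ D)
      (trans (*-cong M₀≈1 (trans (*-identityʳ _) M₀≈1)) (*-identityʳ 1#))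
      (λ k → trans
        (⊗-cong (λ _ → refl) (⊗-cong {a = D} (λ _ → refl) (λ j → sym (⊗-identityʳ D j))) k)
        (^-inverse {M} {D} MD≋1 2 k))

    -- The coefficients of M̂′ are (k + 1) M_k, hence M + θM.
    X≋ : X ≋ (M ⊕ θ M) ⊗ (D ⊗ D)
    X≋ = ⊗-cong (λ k → +-congˡ (reflexive (·≡× k (M k)))) inv-M²

    at : ∀ a k → coeff (-[1+ 1 ] , a) (-[1+ 1 ] ℤ.+ + k) ≡ a k
    at a k = coeff-offset -[1+ 1 ] a (-[1+ 1 ] ℤ.+ + k) k
      (AbelianGroup.xyx⁻¹≈y ℤ.+-0-abelianGroup -[1+ 1 ] (+ k))

    Y≋zθE : Y ≋ zPS ⊗ θ E
    Y≋zθE k = begin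
      Y k                                        ≡⟨ ≡.cong₂ _+_ (at X k) (at (λ j → - onePS j) k) ⟩
      X k - onePS k                              ≈⟨ +-congʳ (X≋ k) ⟩
      ((M ⊕ θ M) ⊗ (D ⊗ D)) k - onePS k          ≈⟨ θ-reciprocal {zPS} θ-z {M} {D} {E} MD≋1 D⊕zE≋1 k ⟩
      (zPS ⊗ θ E) k                              ∎

theorem3p1 : {c ℓ : Level} (R : CommutativeRing c ℓ) →
  let open CommutativeRing R
      open Series R
  in (C δ M : ℕ → Carrier) →
     δ 0 ≈ 1# →
     (∀ k → shift1 M k ≈ (zPS ⊗ inv (onePS ⊖ (zPS ⊗ (Cser C ∘ps (shift1 M ⊙ shift1 δ))))) k) →
     ∀ n → n ≥ 2 →
     (n ∸ 1) · C n ≈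
       coeff ((((fromPS (deriv (shift1 M)) /L (fromPS₁ (shift1 M) ^L 2)) -L zpow -[1+ 1 ])
               /L (fromPS₁ (shift1 M ⊙ shift1 δ) ^L (n ∸ 1))))
             -[1+ 0 ]
theorem3p1 R C δ M δ₀≈1 eq (suc (suc i)) (s≤s (s≤s _)) =
  LagrangeInversion.cumulant-formula R C δ M δ₀≈1 eq i
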